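{- Let $G$ be a $(k+1)$-critical hypergraph with $k\ge3$. If there exist a vertex $v\in V(G)$ and an edge $e\in E(G)$ such that $v$ is a separating vertex of $G-e$ (regardless of whether $v\in e$), then $G$ is a Hajós join of two hypergraphs.
   Context: A hypergraph is a pair $G=(V,E)$ of finite sets with $E\subseteq 2^V$ and $|e|\ge2$ for all $e\in E$ (no multiple edges). A coloring requires every edge to contain two vertices of different colors; $\chi$ is the chromatic number. $G$ is $(k+1)$-critical if $\chi(G)=k+1$ but $\chi(H)\le k$ for every proper subhypergraph $H$. $G-e$ is obtained by deleting the edge $e$. A vertex $v$ is a separating vertex of a hypergraph $H$ if $H$ is the union of two induced subhypergraphs $H_1,H_2$ with $V(H_1)\cap V(H_2)=\{v\}$ and $|V(H_i)|\ge2$. Hajós join: for vertex-disjoint $G_1,G_2$, $e_i\in E(G_i)$, $v_i\in e_i$, delete $e_1,e_2$, identify $v_1,v_2$ into a new vertex $v^*$, and add a new edge $e^*$ equal to $(e_1\cup e_2)\setminus\{v_1,v_2\}$ or to $((e_1\cup e_2)\setminus\{v_1,v_2\})\cup\{v^*\}$. -}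

module Defs where

open import Data.Bool.Base using (Bool; true; false; if_then_else_)
open import Data.Bool.Properties using () renaming (_≟_ to _≟ᵇ_)
open import Data.Fin.Base using (Fin; zero; suc; _↑ˡ_; _↑ʳ_; splitAt)
open import Data.Fin.Properties
  using (_≟_; any?; suc-injective; ↑ˡ-injective; ↑ʳ-injective; splitAt-↑ˡ; splitAt-↑ʳ)
open import Data.Fin.Subset
  using (Subset; _∈_; _⊆_; _∪_; _∩_; _-_; ⁅_⁆; ∣_∣)
open import Data.Fin.Subset.Properties
  using ( _∈?_; _⊆?_; anySubset?; nonempty?; Empty-unique; ∣⊥∣≡0; ∣⁅x⁆∣≡1; x∈⁅y⁆⇒x≡y
        ; p⊆q⇒∣p∣≤∣q∣; x∈p∧x≢y⇒x∈p-y; x∈p⇒∣p-x∣<∣p∣; p⊆p∪q; q⊆p∪q; x∈p∪q⁻; p─q⊆p; x∈⁅x⁆)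
open import Data.Nat.Base using (ℕ; suc; _+_; _≤_; _<_; s≤s)
open import Data.Nat.Properties using (≤-trans; ≤-reflexive; n≮0)
open import Data.Product.Base using (Σ; ∃; ∃₂; _×_; _,_; proj₁; proj₂)
open import Data.Sum.Base using (_⊎_; inj₁; inj₂; [_,_]′)
open import Data.Vec.Base using (tabulate)
open import Data.Vec.Properties using (≡-dec; lookup∘tabulate; []=⇒lookup; lookup⇒[]=)
open import Function.Base using (_∘_)
open import Function.Bundles using (_⇔_; _↔_; Inverse)
open import Function.Definitions using (Injective)
open import Level using (0ℓ)
open import Relation.Binary.PropositionalEquality
  using (_≡_; _≢_; refl; sym; trans; cong; subst)
open import Relation.Nullary using (¬_; yes; no; does; contradiction)
open import Relation.Nullary.Decidable using (_×-dec_; _⊎-dec_; ¬?; dec-true)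
open import Relation.Unary using (Pred; Decidable)

private
  variable
    m n : ℕ

-- The vertex set is an arbitrary subset of the ambient finite set Fin n, so
-- that a hypergraph and all its subhypergraphs have the same type.  The edge
-- set is a decidable set of subsets, so there are no multiple edges.

record Hypergraph (n : ℕ) : Set₁ where
  field
    V     : Subset n
    E     : Pred (Subset n) 0ℓ
    E?    : Decidable E
    E⊆V   : ∀ {e} → E e → e ⊆ V
    2≤∣E∣ : ∀ {e} → E e → 2 ≤ ∣ e ∣

open Hypergraph public

infix 4 _≈_ _⊑_ _⊏_

_≈_ : Hypergraph n → Hypergraph n → Set
H ≈ G = V H ≡ V G × (∀ e → E H e ⇔ E G e)

_⊑_ : Hypergraph n → Hypergraph n → Set
H ⊑ G = V H ⊆ V G × (∀ {e} → E H e → E G e)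

_⊏_ : Hypergraph n → Hypergraph n → Set
H ⊏ G = H ⊑ G × ¬ H ≈ G

-- Only the values of c on V G matter.

IsColouring : Hypergraph n → ℕ → (Fin n → ℕ) → Set
IsColouring G k c =
  (∀ {x} → x ∈ V G → c x < k) ×
  (∀ {e} → E G e → ∃₂ λ x y → x ∈ e × y ∈ e × c x ≢ c y)

Colourable : Hypergraph n → ℕ → Set
Colourable G k = ∃ (IsColouring G k)

HasChromaticNumber : Hypergraph n → ℕ → Set
HasChromaticNumber G k = Colourable G k × (∀ {j} → Colourable G j → k ≤ j)

[_+1]-Critical : ℕ → Hypergraph n → Set₁
[ k +1]-Critical G =
  HasChromaticNumber G (suc k) ×
  (∀ H → H ⊏ G → ∃ λ j → HasChromaticNumber H j × j ≤ k)

infixl 6 _∖_ _⊔_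

_∖_ : Hypergraph n → Subset n → Hypergraph n
G ∖ e = record
  { V    = V G
  ; E    = λ e′ → E G e′ × e′ ≢ e
  ; E?   = λ e′ → E? G e′ ×-dec ¬? (≡-dec _≟ᵇ_ e′ e)
  ; E⊆V  = E⊆V G ∘ proj₁
  ; 2≤∣E∣ = 2≤∣E∣ G ∘ proj₁
  }

_⊔_ : Hypergraph n → Hypergraph n → Hypergraph n
G ⊔ H = record
  { V    = V G ∪ V H
  ; E    = λ e → E G e ⊎ E H e
  ; E?   = λ e → E? G e ⊎-dec E? H e
  ; E⊆V  = λ { (inj₁ p) → p⊆p∪q (V H) ∘ E⊆V G p
             ; (inj₂ p) → q⊆p∪q (V G) (V H) ∘ E⊆V H p }
  ; 2≤∣E∣ = [ 2≤∣E∣ G , 2≤∣E∣ H ]′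
  }

induced : (G : Hypergraph n) (X : Subset n) → Hypergraph n
induced G X = record
  { V    = X
  ; E    = λ e → E G e × e ⊆ X
  ; E?   = λ e → E? G e ×-dec (e ⊆? X)
  ; E⊆V  = proj₂
  ; 2≤∣E∣ = 2≤∣E∣ G ∘ proj₁
  }

addEdge : (G : Hypergraph n) (e : Subset n) → e ⊆ V G → 2 ≤ ∣ e ∣ → Hypergraph n
addEdge G e e⊆V 2≤∣e∣ = record
  { V    = V G
  ; E    = λ e′ → E G e′ ⊎ e′ ≡ e
  ; E?   = λ e′ → E? G e′ ⊎-dec ≡-dec _≟ᵇ_ e′ e
  ; E⊆V  = λ { (inj₁ p) → E⊆V G p ; (inj₂ refl) → e⊆V }
  ; 2≤∣E∣ = λ { (inj₁ p) → 2≤∣E∣ G p ; (inj₂ refl) → 2≤∣e∣ }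
  }

IsSeparatingVertex : Hypergraph n → Fin n → Set
IsSeparatingVertex H v = ∃₂ λ X₁ X₂ →
  X₁ ⊆ V H × X₂ ⊆ V H ×
  H ≈ induced H X₁ ⊔ induced H X₂ ×
  X₁ ∩ X₂ ≡ ⁅ v ⁆ ×
  2 ≤ ∣ X₁ ∣ × 2 ≤ ∣ X₂ ∣

Vertex : Hypergraph n → Set
Vertex G = ∃ (_∈ V G)

-- For e ⊆ V G and e′ ⊆ V H, the condition on φ says that e′ is the image of e
-- under the bijection φ.

record _≅_ (G : Hypergraph m) (H : Hypergraph n) : Set where
  field
    φ       : Vertex G ↔ Vertex H
    φ-edges : ∀ {e e′} → e ⊆ V G → e′ ⊆ V H →
              (∀ x → proj₁ x ∈ e ⇔ proj₁ (Inverse.to φ x) ∈ e′) →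
              E G e ⇔ E H e′

two-elements⁺ : {p : Subset n} {x y : Fin n} → x ∈ p → y ∈ p → x ≢ y → 2 ≤ ∣ p ∣
two-elements⁺ {p = p} {x} {y} x∈p y∈p x≢y =
  ≤-trans (s≤s (≤-trans (≤-reflexive (sym (∣⁅x⁆∣≡1 y))) (p⊆q⇒∣p∣≤∣q∣ ⁅y⁆⊆p-x)))
          (x∈p⇒∣p-x∣<∣p∣ x∈p)
  where
  ⁅y⁆⊆p-x : ⁅ y ⁆ ⊆ p - x
  ⁅y⁆⊆p-x z∈⁅y⁆ with refl ← x∈⁅y⁆⇒x≡y y z∈⁅y⁆ = x∈p∧x≢y⇒x∈p-y y∈p (x≢y ∘ sym)

another-element : {p : Subset n} → 2 ≤ ∣ p ∣ → ∀ v → ∃ λ x → x ∈ p × x ≢ v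
another-element {p = p} 2≤∣p∣ v with any? (λ x → (x ∈? p) ×-dec ¬? (x ≟ v))
... | yes found = found
... | no  none  =
  contradiction (≤-trans 2≤∣p∣ (≤-trans (p⊆q⇒∣p∣≤∣q∣ p⊆⁅v⁆) (≤-reflexive (∣⁅x⁆∣≡1 v))))
                λ { (s≤s ()) }
  where
  p⊆⁅v⁆ : p ⊆ ⁅ v ⁆
  p⊆⁅v⁆ {x} x∈p with x ≟ v
  ... | yes refl = x∈⁅x⁆ x
  ... | no  x≢v  = contradiction (x , x∈p , x≢v) none

image : (Fin m → Fin n) → Subset m → Subset n
image f p = tabulate λ y → does (any? λ x → (x ∈? p) ×-dec (f x ≟ y))

∈-image⁺ : (f : Fin m → Fin n) (p : Subset m) {x : Fin m} → x ∈ p → f x ∈ image f p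
∈-image⁺ f p {x} x∈p =
  lookup⇒[]= (f x) _ (trans (lookup∘tabulate _ (f x)) (dec-true (any? _) (x , x∈p , refl)))

∈-image⁻ : (f : Fin m → Fin n) (p : Subset m) {y : Fin n} →
           y ∈ image f p → ∃ λ x → x ∈ p × f x ≡ y
∈-image⁻ f p {y} y∈ with any? (λ x → (x ∈? p) ×-dec (f x ≟ y))
                       | trans (sym (lookup∘tabulate _ y)) ([]=⇒lookup y∈)
... | yes w | _ = w

image-mono : (f : Fin m → Fin n) {p q : Subset m} → p ⊆ q → image f p ⊆ image f q
image-mono f {p} {q} p⊆q y∈ with x , x∈p , refl ← ∈-image⁻ f p y∈ = ∈-image⁺ f q (p⊆q x∈p)

rename : (f : Fin m → Fin n) → Injective _≡_ _≡_ f → Hypergraph m → Hypergraph n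
rename {m = m} f f-inj G = record
  { V    = image f (V G)
  ; E    = λ e′ → ∃ λ e → E G e × e′ ≡ image f e
  ; E?   = λ e′ → anySubset? λ e → E? G e ×-dec ≡-dec _≟ᵇ_ e′ (image f e)
  ; E⊆V  = λ { (e , Ee , refl) → image-mono f (E⊆V G Ee) }
  ; 2≤∣E∣ = λ { (e , Ee , refl) → size e (2≤∣E∣ G Ee) }
  }
  where
  size : ∀ e → 2 ≤ ∣ e ∣ → 2 ≤ ∣ image f e ∣
  size e 2≤∣e∣ with nonempty? e
  ... | no  empty   =
    contradiction (subst (2 ≤_) (trans (cong ∣_∣ (Empty-unique empty)) (∣⊥∣≡0 m)) 2≤∣e∣) n≮0
  ... | yes (x , x∈e) with y , y∈e , y≢x ← another-element 2≤∣e∣ x =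
    two-elements⁺ (∈-image⁺ f e x∈e) (∈-image⁺ f e y∈e) (y≢x ∘ sym ∘ f-inj)

-- Vertex-disjointness is achieved by placing G₁ and G₂ into the two summands of
-- Fin (n₁ + n₂); the extra element zero of Fin (suc (n₁ + n₂)) is the new
-- vertex v*, which replaces both v₁ and v₂.

module HajósJoin {n₁ n₂ : ℕ}
  (G₁ : Hypergraph n₁) {e₁ : Subset n₁} (Ee₁ : E G₁ e₁) {v₁ : Fin n₁} (v₁∈e₁ : v₁ ∈ e₁)
  (G₂ : Hypergraph n₂) {e₂ : Subset n₂} (Ee₂ : E G₂ e₂) {v₂ : Fin n₂} (v₂∈e₂ : v₂ ∈ e₂)
  where

  v* : Fin (suc (n₁ + n₂))
  v* = zero

  ι₁ : Fin n₁ → Fin (suc (n₁ + n₂))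
  ι₁ x = if does (x ≟ v₁) then v* else suc (x ↑ˡ n₂)

  ι₂ : Fin n₂ → Fin (suc (n₁ + n₂))
  ι₂ x = if does (x ≟ v₂) then v* else suc (n₁ ↑ʳ x)

  ι₁-injective : Injective _≡_ _≡_ ι₁
  ι₁-injective {x} {y} eq with x ≟ v₁ | y ≟ v₁
  ... | yes x≡v | yes y≡v = trans x≡v (sym y≡v)
  ... | no  _   | no  _   = ↑ˡ-injective n₂ x y (suc-injective eq)

  ι₂-injective : Injective _≡_ _≡_ ι₂
  ι₂-injective {x} {y} eq with x ≟ v₂ | y ≟ v₂
  ... | yes x≡v | yes y≡v = trans x≡v (sym y≡v)
  ... | no  _   | no  _   = ↑ʳ-injective n₁ x y (suc-injective eq)

  ι₁≢ι₂ : ∀ {x y} → x ≢ v₁ → ι₁ x ≢ ι₂ y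
  ι₁≢ι₂ {x} {y} x≢v eq with x ≟ v₁ | y ≟ v₂
  ... | yes x≡v | _    = x≢v x≡v
  ... | no  _   | no _
    with () ← trans (sym (splitAt-↑ˡ n₁ x n₂))
                    (trans (cong (splitAt n₁) (suc-injective eq)) (splitAt-↑ʳ n₁ n₂ y))

  identified : Hypergraph (suc (n₁ + n₂))
  identified = rename ι₁ ι₁-injective (G₁ ∖ e₁) ⊔ rename ι₂ ι₂-injective (G₂ ∖ e₂)

  e° : Subset (suc (n₁ + n₂))
  e° = image ι₁ (e₁ - v₁) ∪ image ι₂ (e₂ - v₂)

  e* : Bool → Subset (suc (n₁ + n₂))
  e* false = e°
  e* true  = e° ∪ ⁅ v* ⁆

  e°⊆V : e° ⊆ V identified
  e°⊆V x∈e° with x∈p∪q⁻ (image ι₁ (e₁ - v₁)) _ x∈e°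
  ... | inj₁ p = p⊆p∪q (image ι₂ (V G₂))
                   (image-mono ι₁ (E⊆V G₁ Ee₁ ∘ p─q⊆p e₁ ⁅ v₁ ⁆) p)
  ... | inj₂ p = q⊆p∪q (image ι₁ (V G₁)) _
                   (image-mono ι₂ (E⊆V G₂ Ee₂ ∘ p─q⊆p e₂ ⁅ v₂ ⁆) p)

  v*∈V : v* ∈ V identified
  v*∈V = p⊆p∪q (image ι₂ (V G₂))
    (subst (_∈ image ι₁ (V G₁))
           (cong (if_then v* else suc (v₁ ↑ˡ n₂)) (dec-true (v₁ ≟ v₁) refl))
           (∈-image⁺ ι₁ (V G₁) (E⊆V G₁ Ee₁ v₁∈e₁)))

  e*⊆V : ∀ b → e* b ⊆ V identified
  e*⊆V false = e°⊆V
  e*⊆V true x∈ with x∈p∪q⁻ e° _ x∈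
  ... | inj₁ p = e°⊆V p
  ... | inj₂ p with refl ← x∈⁅y⁆⇒x≡y v* p = v*∈V

  2≤∣e°∣ : 2 ≤ ∣ e° ∣
  2≤∣e°∣ with x , x∈ , x≢ ← another-element (2≤∣E∣ G₁ Ee₁) v₁
            | y , y∈ , y≢ ← another-element (2≤∣E∣ G₂ Ee₂) v₂ =
    two-elements⁺ (p⊆p∪q _ (∈-image⁺ ι₁ _ (x∈p∧x≢y⇒x∈p-y x∈ x≢)))
                  (q⊆p∪q (image ι₁ (e₁ - v₁)) _ (∈-image⁺ ι₂ _ (x∈p∧x≢y⇒x∈p-y y∈ y≢)))
                  (ι₁≢ι₂ x≢)

  2≤∣e*∣ : ∀ b → 2 ≤ ∣ e* b ∣
  2≤∣e*∣ false = 2≤∣e°∣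
  2≤∣e*∣ true  = ≤-trans 2≤∣e°∣ (p⊆q⇒∣p∣≤∣q∣ (p⊆p∪q {p = e°} ⁅ v* ⁆))

  -- The Boolean says whether v* belongs to the new edge.

  hajósJoin : Bool → Hypergraph (suc (n₁ + n₂))
  hajósJoin b = addEdge identified (e* b) (e*⊆V b) (2≤∣e*∣ b)

open HajósJoin public using (hajósJoin)

IsHajósJoinOf : ∀ {n n₁ n₂} → Hypergraph n → Hypergraph n₁ → Hypergraph n₂ → Set
IsHajósJoinOf G G₁ G₂ =
  ∃ λ e₁ → Σ (E G₁ e₁) λ Ee₁ → ∃ λ v₁ → Σ (v₁ ∈ e₁) λ v₁∈e₁ →
  ∃ λ e₂ → Σ (E G₂ e₂) λ Ee₂ → ∃ λ v₂ → Σ (v₂ ∈ e₂) λ v₂∈e₂ →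
  ∃ λ b → G ≅ hajósJoin G₁ Ee₁ v₁∈e₁ G₂ Ee₂ v₂∈e₂ b

{-# OPTIONS --safe #-}

-- Let X₁ and X₂ be the two sides of a separation of G − e at v.  Both sides
-- meet e outside v, for otherwise v would separate G itself, and k-colourings
-- of G[X₁] and G[X₂] that agree at v could be glued.  Moreover every
-- k-colouring c of G − e is constant on e ∪ {v}: it is constant on e since G is
-- not k-colourable, and if this colour a were different from c(v), then
-- exchanging a on X₂ with a third colour would properly colour e.  Hence no
-- edge of G − e lies in e ∪ {v}, so that eᵢ = (e ∩ Xᵢ) ∪ {v} is a new edge for
-- (G − e)[Xᵢ], and G is the Hajós join of the hypergraphs (G − e)[Xᵢ] + eᵢ.

module Submission where

open import Defs
open import Data.Bool.Base using (Bool; true; false; if_then_else_)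
open import Data.Bool.Properties using () renaming (_≟_ to _≟ᵇ_)
open import Data.Fin.Base using (Fin; zero; suc; _↑ˡ_; _↑ʳ_; splitAt)
open import Data.Fin.Properties using (_≟_; any?; splitAt-↑ˡ; splitAt-↑ʳ)
open import Data.Fin.Subset
  using (Subset; _∈_; _⊆_; _∪_; _∩_; _-_; ⁅_⁆; ∣_∣)
open import Data.Fin.Subset.Properties
  using ( _∈?_; x∈⁅x⁆; x∈⁅y⁆⇒x≡y; x∈p∧x≢y⇒x∈p-y; x∈p∪q⁻; x∈p∪q⁺; x∈p∩q⁺; x∈p∩q⁻; p─q⊆p
        ; ⊆-antisym)
open import Data.Nat.Base using (ℕ; suc; _+_; _≤_; _<_; s≤s; z≤n)
open import Data.Nat.Properties using (≤-trans; <-≤-trans; 1+n≰n) renaming (_≟_ to _≟ℕ_)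
open import Data.Product.Base using (∃; ∃₂; _×_; _,_; proj₁; proj₂)
open import Data.Sum.Base using (_⊎_; inj₁; inj₂; [_,_]′) renaming (swap to ⊎-swap)
open import Data.Vec.Base using (_∷_; there)
open import Data.Vec.Properties using (≡-dec)
open import Data.Vec.Properties.WithK using ([]=-irrelevant)
open import Function.Base using (_∘_; id)
open import Function.Bundles using (_⇔_; Equivalence; mk⇔; mk↔ₛ′)
open import Relation.Binary.PropositionalEquality
  using (_≡_; _≢_; refl; sym; trans; cong; subst)
open import Relation.Nullary using (Dec; ¬_; yes; no; does; contradiction)
open import Relation.Nullary.Decidable using (_×-dec_; ¬?; dec-true; decidable-stable)

private
  variable
    m n k : ℕ

-- Vertices, images and deletions in finite sets.

vertex-≡ : {G : Hypergraph n} {x y : Vertex G} → proj₁ x ≡ proj₁ y → x ≡ y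
vertex-≡ {x = x , p} {.x , q} refl = cong (x ,_) ([]=-irrelevant p q)

image-injective : {f : Fin m → Fin n} → (∀ {x y} → f x ≡ f y → x ≡ y) →
                  ∀ {p q} → image f p ≡ image f q → p ≡ q
image-injective {f = f} f-inj eq = ⊆-antisym (back _ _ eq) (back _ _ (sym eq))
  where
  back : ∀ p q → image f p ≡ image f q → p ⊆ q
  back p q eq x∈p with y , y∈q , fy≡fx ← ∈-image⁻ f q (subst (f _ ∈_) eq (∈-image⁺ f p x∈p)) =
    subst (_∈ q) (f-inj fy≡fx) y∈q

-- Agreement on `p` suffices: the vertex map `h` agrees with `ι₁` on `X₁` and with `ι₂` on `X₂`, but
-- with neither everywhere.
image-cong : {f g : Fin m → Fin n} {p : Subset m} →
             (∀ {x} → x ∈ p → f x ≡ g x) → image f p ≡ image g p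
image-cong {p = p} f≗g = ⊆-antisym (sub f≗g) (sub (sym ∘ f≗g))
  where
  sub : ∀ {f g} → (∀ {x} → x ∈ p → f x ≡ g x) → image f p ⊆ image g p
  sub {f} {g} f≗g y∈ with x , x∈p , refl ← ∈-image⁻ f p y∈ =
    subst (_∈ image g p) (sym (f≗g x∈p)) (∈-image⁺ g p x∈p)

x∉p-x : ∀ (p : Subset n) x → ¬ x ∈ p - x
x∉p-x (false ∷ p) zero    ()
x∉p-x (true  ∷ p) zero    ()
x∉p-x (false ∷ p) (suc x) (there x∈) = x∉p-x p x x∈
x∉p-x (true  ∷ p) (suc x) (there x∈) = x∉p-x p x x∈

x∈p-y⁻ : ∀ (p : Subset n) y {x} → x ∈ p - y → x ∈ p × x ≢ y
x∈p-y⁻ p y x∈ = p─q⊆p p ⁅ y ⁆ x∈ , λ { refl → x∉p-x p y x∈ }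

-- Exchanging two colours.

transpose : ℕ → ℕ → ℕ → ℕ
transpose a b x with x ≟ℕ a | x ≟ℕ b
... | yes _ | _     = b
... | no _  | yes _ = a
... | no _  | no _  = x

transpose-source : ∀ a b → transpose a b a ≡ b
transpose-source a b with a ≟ℕ a
... | yes _  = refl
... | no a≢a = contradiction refl a≢a

transpose-fixes : ∀ {a b x} → x ≢ a → x ≢ b → transpose a b x ≡ x
transpose-fixes {a} {b} {x} x≢a x≢b with x ≟ℕ a | x ≟ℕ b
... | yes x≡a | _       = contradiction x≡a x≢a
... | no _    | yes x≡b = contradiction x≡b x≢b
... | no _    | no _    = refl

transpose-< : ∀ {a b x} → a < k → b < k → x < k → transpose a b x < k
transpose-< {a = a} {b} {x} a<k b<k x<k with x ≟ℕ a | x ≟ℕ b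
... | yes _ | _     = b<k
... | no _  | yes _ = a<k
... | no _  | no _  = x<k

transpose-injective : ∀ a b {x y} → transpose a b x ≡ transpose a b y → x ≡ y
transpose-injective a b {x} {y} eq with x ≟ℕ a | x ≟ℕ b | y ≟ℕ a | y ≟ℕ b
... | yes p | _     | yes q | _     = trans p (sym q)
... | yes p | _     | no ¬q | yes q = trans p (trans (sym eq) (sym q))
... | yes p | _     | no _  | no ¬q = contradiction (sym eq) ¬q
... | no ¬p | yes p | yes q | _     = trans p (trans (sym eq) (sym q))
... | no _  | yes p | no _  | yes q = trans p (sym q)
... | no _  | yes p | no ¬q | no _  = contradiction (sym eq) ¬q
... | no _  | no ¬p | yes q | _     = contradiction eq ¬p
... | no ¬p | no _  | no _  | yes q = contradiction eq ¬p
... | no _  | no _  | no _  | no _  = eq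

-- This is where `3 ≤ k` enters. The witness is always the least colour different from `a` and `b`.
third : 3 ≤ k → ∀ a b → ∃ λ d → d < k × d ≢ a × d ≢ b
third 3≤k 0             0             = 1 , ≤-trans (s≤s (s≤s z≤n)) 3≤k , (λ ()) , λ ()
third 3≤k 0             1             = 2 , 3≤k , (λ ()) , λ ()
third 3≤k 0             (suc (suc b)) = 1 , ≤-trans (s≤s (s≤s z≤n)) 3≤k , (λ ()) , λ ()
third 3≤k 1             0             = 2 , 3≤k , (λ ()) , λ ()
third 3≤k (suc (suc a)) 0             = 1 , ≤-trans (s≤s (s≤s z≤n)) 3≤k , (λ ()) , λ ()
third 3≤k (suc a)       (suc b)       = 0 , ≤-trans (s≤s z≤n) 3≤k , (λ ()) , λ ()

-- Colourings of critical hypergraphs.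

recolour : (G : Hypergraph n) {c : Fin n → ℕ} {σ : ℕ → ℕ} →
           (∀ {x} → x < k → σ x < k) → (∀ {x y} → σ x ≡ σ y → x ≡ y) →
           IsColouring G k c → IsColouring G k (σ ∘ c)
recolour G σ-< σ-inj (c-< , proper) =
  σ-< ∘ c-< ,
  λ Ef → let x , y , x∈ , y∈ , cx≢cy = proper Ef in x , y , x∈ , y∈ , cx≢cy ∘ σ-inj

restrict : (G : Hypergraph n) {X : Subset n} {c : Fin n → ℕ} →
           X ⊆ V G → IsColouring G k c → IsColouring (induced G X) k c
restrict G X⊆V (c-< , proper) = c-< ∘ X⊆V , proper ∘ proj₁

critical⇒¬colourable : (G : Hypergraph n) → [ k +1]-Critical G → ¬ Colourable G k
critical⇒¬colourable G ((_ , least) , _) col = 1+n≰n (least col)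

critical⇒⊏-colourable : (G : Hypergraph n) → [ k +1]-Critical G → ∀ H → H ⊏ G → Colourable H k
critical⇒⊏-colourable G (_ , sub) H H⊏G with _ , ((c , c-< , proper) , _) , j≤k ← sub H H⊏G =
  c , (λ x∈V → <-≤-trans (c-< x∈V) j≤k) , proper

∖-⊏ : (G : Hypergraph n) {e : Subset n} → E G e → G ∖ e ⊏ G
∖-⊏ G {e} Ee = (id , proj₁) , λ (_ , edges) → proj₂ (Equivalence.from (edges e) Ee) refl

-- If `c` took two colours on `e`, it would be proper on `e` as well and thus a `k`-colouring of
-- `G`.
monochromatic : (G : Hypergraph n) {e : Subset n} {c : Fin n → ℕ} → ¬ Colourable G k →
                IsColouring (G ∖ e) k c → ∀ {x y} → x ∈ e → y ∈ e → c x ≡ c y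
monochromatic G {e} {c} ¬col (c-< , proper) {x} {y} x∈e y∈e =
  decidable-stable (c x ≟ℕ c y) λ cx≢cy → ¬col (c , c-< , properG cx≢cy)
  where
  properG : c x ≢ c y → ∀ {f} → E G f → ∃₂ λ x y → x ∈ f × y ∈ f × c x ≢ c y
  properG cx≢cy {f} Ef with ≡-dec _≟ᵇ_ f e
  ... | yes refl = x , y , x∈e , y∈e , cx≢cy
  ... | no f≢e   = proper (Ef , f≢e)

-- Separations at a vertex, and gluing.

record Separation (H : Hypergraph n) (v : Fin n) (X₁ X₂ : Subset n) : Set where
  field
    X₁⊆V   : X₁ ⊆ V H
    X₂⊆V   : X₂ ⊆ V H
    cover  : ∀ {x} → x ∈ V H → x ∈ X₁ ⊎ x ∈ X₂
    -- The only field that depends on the edges of `H`: a separation of `G − e` becomes one of `G`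
    -- once `e` lies within one side.
    edges  : ∀ {f} → E H f → f ⊆ X₁ ⊎ f ⊆ X₂
    v∈X₁   : v ∈ X₁
    v∈X₂   : v ∈ X₂
    meet   : ∀ {x} → x ∈ X₁ → x ∈ X₂ → x ≡ v
    other₁ : ∃ λ x → x ∈ X₁ × x ≢ v
    other₂ : ∃ λ x → x ∈ X₂ × x ≢ v

open Separation

private
  variable
    v : Fin n
    X₁ X₂ : Subset n

Separation-sym : {H : Hypergraph n} → Separation H v X₁ X₂ → Separation H v X₂ X₁
Separation-sym S = record
  { X₁⊆V = X₂⊆V S ; X₂⊆V = X₁⊆V S
  ; cover = ⊎-swap ∘ cover S ; edges = ⊎-swap ∘ edges S
  ; v∈X₁ = v∈X₂ S ; v∈X₂ = v∈X₁ S
  ; meet = λ p q → meet S q p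
  ; other₁ = other₂ S ; other₂ = other₁ S
  }

fromIsSeparatingVertex : (H : Hypergraph n) → IsSeparatingVertex H v → ∃₂ (Separation H v)
fromIsSeparatingVertex {v = v} H
  (X₁ , X₂ , X₁⊆V , X₂⊆V , (V≡ , E⇔) , X₁∩X₂≡⁅v⁆ , 2≤∣X₁∣ , 2≤∣X₂∣) = X₁ , X₂ , record
  { X₁⊆V = X₁⊆V ; X₂⊆V = X₂⊆V
  ; cover = λ x∈V → x∈p∪q⁻ X₁ X₂ (subst (_ ∈_) V≡ x∈V)
  ; edges = λ {f} Ef → [ inj₁ ∘ proj₂ , inj₂ ∘ proj₂ ]′ (Equivalence.to (E⇔ f) Ef)
  ; v∈X₁ = proj₁ v∈ ; v∈X₂ = proj₂ v∈
  ; meet = λ p q → x∈⁅y⁆⇒x≡y v (subst (_ ∈_) X₁∩X₂≡⁅v⁆ (x∈p∩q⁺ (p , q)))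
  ; other₁ = another-element 2≤∣X₁∣ v ; other₂ = another-element 2≤∣X₂∣ v
  }
  where
  v∈ : v ∈ X₁ × v ∈ X₂
  v∈ = x∈p∩q⁻ X₁ X₂ (subst (v ∈_) (sym X₁∩X₂≡⁅v⁆) (x∈⁅x⁆ v))

module _ {A : Set} {H : Hypergraph n} {v : Fin n} {X₁ X₂ : Subset n}
         (S : Separation H v X₁ X₂) (f₁ f₂ : Fin n → A) where

  -- The value at `v` comes from `f₁`, so only the `X₂` side needs `f₁ v ≡ f₂ v`. The codomain is
  -- arbitrary because colourings and the vertex map `h` are both glued.
  glue : Fin n → A
  glue x = if does (x ∈? X₁) then f₁ x else f₂ x

  glue-X₁ : ∀ {x} → x ∈ X₁ → glue x ≡ f₁ x
  glue-X₁ {x} x∈X₁ = cong (if_then f₁ x else f₂ x) (dec-true (x ∈? X₁) x∈X₁)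

  glue-X₂ : f₁ v ≡ f₂ v → ∀ {x} → x ∈ X₂ → glue x ≡ f₂ x
  glue-X₂ agree {x} x∈X₂ with x ∈? X₁
  ... | no _     = refl
  ... | yes x∈X₁ with refl ← meet S x∈X₁ x∈X₂ = agree

module _ {H : Hypergraph n} {v : Fin n} {X₁ X₂ : Subset n} (S : Separation H v X₁ X₂)
         {c₁ c₂ : Fin n → ℕ}
  where

  -- Every edge lies within one side, where the glued map coincides with the colouring of that side.
  glue-colouring : IsColouring (induced H X₁) k c₁ → IsColouring (induced H X₂) k c₂ →
                   c₁ v ≡ c₂ v → IsColouring H k (glue S c₁ c₂)
  glue-colouring {k} (c₁-< , proper₁) (c₂-< , proper₂) agree = c-< , proper
    where
    c = glue S c₁ c₂

    c≡c₁ : ∀ {x} → x ∈ X₁ → c x ≡ c₁ x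
    c≡c₁ = glue-X₁ S c₁ c₂

    c≡c₂ : ∀ {x} → x ∈ X₂ → c x ≡ c₂ x
    c≡c₂ = glue-X₂ S c₁ c₂ agree

    c-< : ∀ {x} → x ∈ V H → c x < k
    c-< x∈V with cover S x∈V
    ... | inj₁ x∈X₁ = subst (_< k) (sym (c≡c₁ x∈X₁)) (c₁-< x∈X₁)
    ... | inj₂ x∈X₂ = subst (_< k) (sym (c≡c₂ x∈X₂)) (c₂-< x∈X₂)

    proper : ∀ {f} → E H f → ∃₂ λ x y → x ∈ f × y ∈ f × c x ≢ c y
    proper Ef with edges S Ef
    ... | inj₁ f⊆X₁ with x , y , x∈f , y∈f , ≢ ← proper₁ (Ef , f⊆X₁) =
      x , y , x∈f , y∈f ,
      λ eq → ≢ (trans (sym (c≡c₁ (f⊆X₁ x∈f))) (trans eq (c≡c₁ (f⊆X₁ y∈f))))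
    ... | inj₂ f⊆X₂ with x , y , x∈f , y∈f , ≢ ← proper₂ (Ef , f⊆X₂) =
      x , y , x∈f , y∈f ,
      λ eq → ≢ (trans (sym (c≡c₂ (f⊆X₂ x∈f))) (trans eq (c≡c₂ (f⊆X₂ y∈f))))

-- Critical hypergraphs and separating vertices.

induced-⊏ : {G : Hypergraph n} → Separation G v X₁ X₂ → induced G X₁ ⊏ G
induced-⊏ S = (X₁⊆V S , proj₁) , λ (X₁≡V , _) →
  let x , x∈X₂ , x≢v = other₂ S in x≢v (meet S (subst (x ∈_) (sym X₁≡V) (X₂⊆V S x∈X₂)) x∈X₂)

-- Criticality gives `k`-colourings of both sides. Exchanging `c₁ v` and `c₂ v` on the second side
-- makes them agree at `v`, and gluing would then `k`-colour `G`.
critical⇒¬separation : {G : Hypergraph n} → [ k +1]-Critical G → ¬ Separation G v X₁ X₂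
critical⇒¬separation {n} {k} {v} {X₁} {X₂} {G} crit S
  with c₁ , col₁ ← critical⇒⊏-colourable G crit (induced G X₁) (induced-⊏ S)
     | c₂ , col₂ ← critical⇒⊏-colourable G crit (induced G X₂) (induced-⊏ (Separation-sym S)) =
  critical⇒¬colourable G crit
    (_ , glue-colouring S col₁ col₂′ (sym (transpose-source (c₂ v) (c₁ v))))
  where
  col₂′ : IsColouring (induced G X₂) k (transpose (c₂ v) (c₁ v) ∘ c₂)
  col₂′ = recolour (induced G X₂) (transpose-< (proj₁ col₂ (v∈X₂ S)) (proj₁ col₁ (v∈X₁ S)))
                   (transpose-injective (c₂ v) (c₁ v)) col₂

-- The edge `e` when `G − e` is separated at `v`.

module CriticalSeparation
  {G : Hypergraph n} (3≤k : 3 ≤ k) (crit : [ k +1]-Critical G)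
  {v : Fin n} {e : Subset n} (Ee : E G e) where

  -- Otherwise `e` has at most `v` in `X₁`, and `v` also lies in `X₂`; so `e ⊆ X₂`, and the two
  -- sides would separate `G` itself. `Separation-sym` gives the same for `X₂`.
  meets : ∀ {X₁ X₂} → Separation (G ∖ e) v X₁ X₂ → ∃ λ x → x ∈ e × x ∈ X₁ × x ≢ v
  meets {X₁} {X₂} S with any? (λ x → (x ∈? e) ×-dec (x ∈? X₁) ×-dec ¬? (x ≟ v))
  ... | yes found = found
  ... | no none   = contradiction SG (critical⇒¬separation crit)
    where
    e⊆X₂ : e ⊆ X₂
    e⊆X₂ {x} x∈e with cover S (E⊆V G Ee x∈e)
    ... | inj₂ x∈X₂ = x∈X₂
    ... | inj₁ x∈X₁ with x ≟ v
    ...   | yes refl = v∈X₂ S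
    ...   | no x≢v   = contradiction (x , x∈e , x∈X₁ , x≢v) none

    edges′ : ∀ {f} → E G f → f ⊆ X₁ ⊎ f ⊆ X₂
    edges′ {f} Ef with ≡-dec _≟ᵇ_ f e
    ... | yes refl = inj₂ e⊆X₂
    ... | no f≢e   = edges S (Ef , f≢e)

    SG : Separation G v X₁ X₂
    SG = record
      { X₁⊆V = X₁⊆V S ; X₂⊆V = X₂⊆V S ; cover = cover S ; edges = edges′
      ; v∈X₁ = v∈X₁ S ; v∈X₂ = v∈X₂ S ; meet = meet S
      ; other₁ = other₁ S ; other₂ = other₂ S }

  constant : ∀ {X₁ X₂ c} → Separation (G ∖ e) v X₁ X₂ → IsColouring (G ∖ e) k c →
             ∀ {x} → x ∈ e → c x ≡ c v
  constant {X₁} {X₂} {c} S col {x} x∈e = decidable-stable (c x ≟ℕ c v) impossible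
    where
    ¬col = critical⇒¬colourable G crit

    impossible : ¬ c x ≢ c v
    impossible cx≢cv
      with x₁ , x₁∈e , x₁∈X₁ , _ ← meets S
         | x₂ , x₂∈e , x₂∈X₂ , _ ← meets (Separation-sym S)
         | d , d<k , d≢cx , d≢cv ← third 3≤k (c x) (c v) =
      -- `x₁` keeps the colour `c x` and `x₂` receives `d`, although the colouring `c′` has to be
      -- constant on `e`.
      d≢cx (trans (sym c′x₂≡d) (trans (sym c′x₁≡c′x₂) c′x₁≡cx))
      where
      σ = transpose (c x) d

      -- `σ` moves only `c x` and `d`, both different from `c v`, so the two colourings can be glued
      -- at `v`.
      agree : c v ≡ σ (c v)
      agree = sym (transpose-fixes (cx≢cv ∘ sym) (d≢cv ∘ sym))

      c′ = glue S c (σ ∘ c)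

      mono : ∀ {y} → y ∈ e → c y ≡ c x
      mono y∈e = monochromatic G ¬col col y∈e x∈e

      c′-col : IsColouring (G ∖ e) k c′
      c′-col = glue-colouring S (restrict (G ∖ e) (X₁⊆V S) col)
        (recolour (induced (G ∖ e) X₂)
                  (transpose-< (proj₁ col (E⊆V G Ee x∈e)) d<k) (transpose-injective (c x) d)
                  (restrict (G ∖ e) (X₂⊆V S) col))
        agree

      c′x₁≡cx : c′ x₁ ≡ c x
      c′x₁≡cx = trans (glue-X₁ S c (σ ∘ c) x₁∈X₁) (mono x₁∈e)

      c′x₂≡d : c′ x₂ ≡ d
      c′x₂≡d = trans (glue-X₂ S c (σ ∘ c) agree x₂∈X₂)
                     (trans (cong σ (mono x₂∈e)) (transpose-source (c x) d))

      c′x₁≡c′x₂ : c′ x₁ ≡ c′ x₂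
      c′x₁≡c′x₂ = monochromatic G ¬col c′-col x₁∈e x₂∈e

  -- `v` is adjoined even when it is not in `e`: a Hajós join needs an edge through the vertex that
  -- gets identified.
  part : Subset n → Subset n
  part X = (e ∩ X) ∪ ⁅ v ⁆

  -- By criticality `G − e` has a `k`-colouring, and it is constant on `part X`. Hence adding
  -- `part X₁` to its side and deleting it again in the join loses no edge of that side; likewise
  -- for `X₂`.
  part-∉E : ∀ {X₁ X₂} X → Separation (G ∖ e) v X₁ X₂ → ¬ E (G ∖ e) (part X)
  part-∉E X S Ep
    with c , col ← critical⇒⊏-colourable G crit (G ∖ e) (∖-⊏ G Ee)
    with x , y , x∈ , y∈ , cx≢cy ← proj₂ col Ep = cx≢cy (trans (at x∈) (sym (at y∈)))
    where
    at : ∀ {z} → z ∈ part X → c z ≡ c v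
    at z∈ with x∈p∪q⁻ (e ∩ X) ⁅ v ⁆ z∈
    ... | inj₁ z∈e∩X = constant S col (proj₁ (x∈p∩q⁻ e X z∈e∩X))
    ... | inj₂ z∈⁅v⁆ = cong c (x∈⁅y⁆⇒x≡y v z∈⁅v⁆)

  v∈part : ∀ X → v ∈ part X
  v∈part X = x∈p∪q⁺ (inj₂ (x∈⁅x⁆ v))

  side : ∀ {X₁ X₂} → Separation (G ∖ e) v X₁ X₂ → Hypergraph n
  side {X₁} S = addEdge (induced (G ∖ e) X₁) (part X₁) part⊆X₁ 2≤∣part∣
    where
    part⊆X₁ : part X₁ ⊆ X₁
    part⊆X₁ z∈ with x∈p∪q⁻ (e ∩ X₁) ⁅ v ⁆ z∈
    ... | inj₁ z∈e∩X = proj₂ (x∈p∩q⁻ e X₁ z∈e∩X)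
    ... | inj₂ z∈⁅v⁆ = subst (_∈ X₁) (sym (x∈⁅y⁆⇒x≡y v z∈⁅v⁆)) (v∈X₁ S)

    2≤∣part∣ : 2 ≤ ∣ part X₁ ∣
    2≤∣part∣ with x , x∈e , x∈X₁ , x≢v ← meets S =
      two-elements⁺ (x∈p∪q⁺ (inj₁ (x∈p∩q⁺ (x∈e , x∈X₁)))) (v∈part X₁) x≢v

  ∈part-v⁺ : ∀ X {x} → x ∈ e → x ∈ X → x ≢ v → x ∈ part X - v
  ∈part-v⁺ X x∈e x∈X = x∈p∧x≢y⇒x∈p-y (x∈p∪q⁺ (inj₁ (x∈p∩q⁺ (x∈e , x∈X))))

  ∈part-v⁻ : ∀ X {x} → x ∈ part X - v → x ∈ e × x ∈ X
  ∈part-v⁻ X x∈ with x∈part , x≢v ← x∈p-y⁻ (part X) v x∈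
    with x∈p∪q⁻ (e ∩ X) ⁅ v ⁆ x∈part
  ... | inj₁ x∈e∩X = x∈p∩q⁻ e X x∈e∩X
  ... | inj₂ x∈⁅v⁆ = contradiction (x∈⁅y⁆⇒x≡y v x∈⁅v⁆) x≢v

  -- The isomorphism with the Hajós join.

  module _ {X₁ X₂} (S : Separation (G ∖ e) v X₁ X₂) where

    G₁ G₂ : Hypergraph n
    G₁ = side S
    G₂ = side (Separation-sym S)

    open HajósJoin G₁ (inj₂ refl) (v∈part X₁) G₂ (inj₂ refl) (v∈part X₂)
      using (v*; ι₁; ι₂; e°; e*)

    J : Bool → Hypergraph (suc (n + n))
    J = hajósJoin G₁ (inj₂ refl) (v∈part X₁) G₂ (inj₂ refl) (v∈part X₂)

    ι₁v≡v* : ι₁ v ≡ v*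
    ι₁v≡v* = cong (if_then v* else suc (v ↑ˡ n)) (dec-true (v ≟ v) refl)

    ι₂v≡v* : ι₂ v ≡ v*
    ι₂v≡v* = cong (if_then v* else suc (n ↑ʳ v)) (dec-true (v ≟ v) refl)

    -- Gluing is possible since `ι₁` and `ι₂` both send `v` to `v*`. The map is total on `Fin n`:
    -- elements of neither side follow `ι₂`, which keeps it injective.
    h : Fin n → Fin (suc (n + n))
    h = glue S ι₁ ι₂

    h≡ι₁ : ∀ {x} → x ∈ X₁ → h x ≡ ι₁ x
    h≡ι₁ = glue-X₁ S ι₁ ι₂

    h≡ι₂ : ∀ {x} → x ∈ X₂ → h x ≡ ι₂ x
    h≡ι₂ = glue-X₂ S ι₁ ι₂ (trans ι₁v≡v* (sym ι₂v≡v*))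

    -- It forgets in which copy of `Fin n` an element lies. This is only a left inverse of `h`,
    -- which is enough for injectivity.
    h⁻¹ : Fin (suc (n + n)) → Fin n
    h⁻¹ zero    = v
    h⁻¹ (suc y) = [ id , id ]′ (splitAt n y)

    h⁻¹-ι₁ : ∀ x → h⁻¹ (ι₁ x) ≡ x
    h⁻¹-ι₁ x with x ≟ v
    ... | yes x≡v = sym x≡v
    ... | no _    = cong [ id , id ]′ (splitAt-↑ˡ n x n)

    h⁻¹-ι₂ : ∀ x → h⁻¹ (ι₂ x) ≡ x
    h⁻¹-ι₂ x with x ≟ v
    ... | yes x≡v = sym x≡v
    ... | no _    = cong [ id , id ]′ (splitAt-↑ʳ n n x)

    h⁻¹-h : ∀ x → h⁻¹ (h x) ≡ x
    h⁻¹-h x with x ∈? X₁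
    ... | yes _ = h⁻¹-ι₁ x
    ... | no _  = h⁻¹-ι₂ x

    h-injective : ∀ {x y} → h x ≡ h y → x ≡ y
    h-injective {x} {y} eq = trans (sym (h⁻¹-h x)) (trans (cong h⁻¹ eq) (h⁻¹-h y))

    -- The preimage found here serves as the inverse map in `G≅J`.
    VJ⇒image : ∀ b {y} → y ∈ V (J b) → ∃ λ x → x ∈ V G × h x ≡ y
    VJ⇒image b y∈ with x∈p∪q⁻ (image ι₁ X₁) (image ι₂ X₂) y∈
    ... | inj₁ y∈₁ with x , x∈X₁ , refl ← ∈-image⁻ ι₁ X₁ y∈₁ = x , X₁⊆V S x∈X₁ , h≡ι₁ x∈X₁
    ... | inj₂ y∈₂ with x , x∈X₂ , refl ← ∈-image⁻ ι₂ X₂ y∈₂ = x , X₂⊆V S x∈X₂ , h≡ι₂ x∈X₂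

    h∈VJ : ∀ b {x} → x ∈ V G → h x ∈ V (J b)
    h∈VJ b x∈V with cover S x∈V
    ... | inj₁ x∈X₁ = x∈p∪q⁺ (inj₁ (subst (_∈ image ι₁ X₁) (sym (h≡ι₁ x∈X₁)) (∈-image⁺ ι₁ X₁ x∈X₁)))
    ... | inj₂ x∈X₂ = x∈p∪q⁺ (inj₂ (subst (_∈ image ι₂ X₂) (sym (h≡ι₂ x∈X₂)) (∈-image⁺ ι₂ X₂ x∈X₂)))

    e°⊆image : e° ⊆ image h e
    e°⊆image y∈ with x∈p∪q⁻ (image ι₁ (part X₁ - v)) (image ι₂ (part X₂ - v)) y∈
    ... | inj₁ y∈₁ with x , x∈ , refl ← ∈-image⁻ ι₁ (part X₁ - v) y∈₁
                   with x∈e , x∈X₁ ← ∈part-v⁻ X₁ x∈ =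
      subst (_∈ image h e) (h≡ι₁ x∈X₁) (∈-image⁺ h e x∈e)
    ... | inj₂ y∈₂ with x , x∈ , refl ← ∈-image⁻ ι₂ (part X₂ - v) y∈₂
                   with x∈e , x∈X₂ ← ∈part-v⁻ X₂ x∈ =
      subst (_∈ image h e) (h≡ι₂ x∈X₂) (∈-image⁺ h e x∈e)

    h∈e° : ∀ {x} → x ∈ e → x ≢ v → h x ∈ e°
    h∈e° {x} x∈e x≢v with cover S (E⊆V G Ee x∈e)
    ... | inj₁ x∈X₁ = x∈p∪q⁺ (inj₁ (subst (_∈ image ι₁ (part X₁ - v)) (sym (h≡ι₁ x∈X₁))
                        (∈-image⁺ ι₁ (part X₁ - v) (∈part-v⁺ X₁ x∈e x∈X₁ x≢v))))
    ... | inj₂ x∈X₂ = x∈p∪q⁺ (inj₂ (subst (_∈ image ι₂ (part X₂ - v)) (sym (h≡ι₂ x∈X₂))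
                        (∈-image⁺ ι₂ (part X₂ - v) (∈part-v⁺ X₂ x∈e x∈X₂ x≢v))))

    hv≡v* : h v ≡ v*
    hv≡v* = trans (h≡ι₁ (v∈X₁ S)) ι₁v≡v*

    -- `e°` is the image under `h` of `e` without `v`, and `h v ≡ v*`; so the Boolean records
    -- whether `v ∈ e`.
    image-e : ∃ λ b → image h e ≡ e* b
    image-e with v ∈? e
    ... | no v∉e = false , ⊆-antisym sub e°⊆image
      where
      sub : image h e ⊆ e°
      sub y∈ with x , x∈e , refl ← ∈-image⁻ h e y∈ = h∈e° x∈e λ { refl → v∉e x∈e }
    ... | yes v∈e = true , ⊆-antisym sub sup
      where
      h∈ : ∀ {x} → x ∈ e → Dec (x ≡ v) → h x ∈ e° ∪ ⁅ v* ⁆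
      h∈ x∈e (no x≢v)   = x∈p∪q⁺ (inj₁ (h∈e° x∈e x≢v))
      h∈ x∈e (yes refl) = x∈p∪q⁺ {p = e°} (inj₂ (subst (_∈ ⁅ v* ⁆) (sym hv≡v*) (x∈⁅x⁆ v*)))

      sub : image h e ⊆ e° ∪ ⁅ v* ⁆
      sub y∈ with x , x∈e , refl ← ∈-image⁻ h e y∈ = h∈ x∈e (x ≟ v)

      sup : e° ∪ ⁅ v* ⁆ ⊆ image h e
      sup y∈ with x∈p∪q⁻ e° ⁅ v* ⁆ y∈
      ... | inj₁ y∈e° = e°⊆image y∈e°
      ... | inj₂ y∈⁅⁆ = subst (_∈ image h e) (trans hv≡v* (sym (x∈⁅y⁆⇒x≡y v* y∈⁅⁆)))
                              (∈-image⁺ h e v∈e)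

    module _ {b} (image-e≡e* : image h e ≡ e* b) where

      E⇒EJ : ∀ {f} → E G f → E (J b) (image h f)
      E⇒EJ {f} Ef with ≡-dec _≟ᵇ_ f e
      ... | yes refl = inj₂ image-e≡e*
      ... | no f≢e with edges S (Ef , f≢e)
      -- The join deletes `part X₁` and `part X₂` from the sides; by `part-∉E`, `f` is neither of
      -- them and survives.
      ...   | inj₁ f⊆X₁ = inj₁ (inj₁ (f , (inj₁ ((Ef , f≢e) , f⊆X₁) ,
                            λ { refl → part-∉E X₁ S (Ef , f≢e) }) , image-cong (h≡ι₁ ∘ f⊆X₁)))
      ...   | inj₂ f⊆X₂ = inj₁ (inj₂ (f , (inj₁ ((Ef , f≢e) , f⊆X₂) ,
                            λ { refl → part-∉E X₂ S (Ef , f≢e) }) , image-cong (h≡ι₂ ∘ f⊆X₂)))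

      -- Each edge of the join is the image under `h` of an edge of `G`, and injectivity of `h`
      -- identifies that edge with `f`.
      EJ⇒E : ∀ {f} → E (J b) (image h f) → E G f
      -- The edge added to a side is precisely the one that the join deletes there.
      EJ⇒E (inj₁ (inj₁ (_ , (inj₂ q≡ , q≢) , _))) = contradiction q≡ q≢
      EJ⇒E (inj₁ (inj₂ (_ , (inj₂ q≡ , q≢) , _))) = contradiction q≡ q≢
      EJ⇒E (inj₁ (inj₁ (q , (inj₁ ((Eq , _) , q⊆X₁) , _) , eq))) =
        subst (E G) (sym (image-injective h-injective (trans eq (sym (image-cong (h≡ι₁ ∘ q⊆X₁)))))) Eq
      EJ⇒E (inj₁ (inj₂ (q , (inj₁ ((Eq , _) , q⊆X₂) , _) , eq))) =
        subst (E G) (sym (image-injective h-injective (trans eq (sym (image-cong (h≡ι₂ ∘ q⊆X₂)))))) Eq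
      EJ⇒E (inj₂ eq) =
        subst (E G) (sym (image-injective h-injective (trans eq (sym image-e≡e*)))) Ee

      G≅J : G ≅ J b
      G≅J = record
        { φ = mk↔ₛ′ to from
                (λ (_ , y∈) → let _ , _ , hx≡y = VJ⇒image b y∈ in vertex-≡ {G = J b} hx≡y)
                (λ (_ , x∈) → let _ , _ , hx′≡hx = VJ⇒image b (h∈VJ b x∈)
                              in vertex-≡ {G = G} (h-injective hx′≡hx))
        ; φ-edges = λ {f} {f′} f⊆V f′⊆V f⇔f′ →
            -- The hypothesis links `f` and `f′` only through membership of vertices. As both are
            -- sets of vertices, this forces `f′` to be `image h f`.
            let f′≡ = image≡ f⊆V f′⊆V f⇔f′ in
            mk⇔ (subst (E (J b)) f′≡ ∘ E⇒EJ) (EJ⇒E ∘ subst (E (J b)) (sym f′≡))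
        }
        where
        to : Vertex G → Vertex (J b)
        to (x , x∈V) = h x , h∈VJ b x∈V

        from : Vertex (J b) → Vertex G
        from (_ , y∈) = let x , x∈V , _ = VJ⇒image b y∈ in x , x∈V

        image≡ : ∀ {f f′} → f ⊆ V G → f′ ⊆ V (J b) →
                 (∀ x → proj₁ x ∈ f ⇔ h (proj₁ x) ∈ f′) → image h f ≡ f′
        image≡ {f} {f′} f⊆V f′⊆V f⇔f′ = ⊆-antisym sub sup
          where
          sub : image h f ⊆ f′
          sub y∈ with x , x∈f , refl ← ∈-image⁻ h f y∈ = Equivalence.to (f⇔f′ (x , f⊆V x∈f)) x∈f

          sup : f′ ⊆ image h f
          sup y∈ with x , x∈V , refl ← VJ⇒image b (f′⊆V y∈) =
            ∈-image⁺ h f (Equivalence.from (f⇔f′ (x , x∈V)) y∈)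

theorem10 : ∀ {n k : ℕ} (G : Hypergraph n) → 3 ≤ k → [ k +1]-Critical G →
    (∃₂ λ (v : Fin n) (e : Subset n) → v ∈ V G × E G e × IsSeparatingVertex (G ∖ e) v) →
    ∃₂ λ (n₁ n₂ : ℕ) → ∃₂ λ (G₁ : Hypergraph n₁) (G₂ : Hypergraph n₂) → IsHajósJoinOf G G₁ G₂
theorem10 G 3≤k crit (v , e , _ , Ee , sep)
  with X₁ , X₂ , S ← fromIsSeparatingVertex (G ∖ e) sep
  with b , image-e≡e* ← CriticalSeparation.image-e {G = G} 3≤k crit Ee S =
  -- Both sides keep the ambient `Fin n` and the vertex `v`; the join itself makes them disjoint.
  -- `inj₂ refl` selects the added edge of each side.
  _ , _ , G₁ S , G₂ S , part X₁ , inj₂ refl , v , v∈part X₁ ,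
  part X₂ , inj₂ refl , v , v∈part X₂ , b , G≅J S {b} image-e≡e*
  where open CriticalSeparation {G = G} 3≤k crit Ee
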